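{- Let $n$ be a non-negative integer and $m$ an integer with $n+m>0$ and $m-1\le n$. Then $$\sum_{j=0}^{n+m}\sum_{k=0}^{n+m-j}\frac{(-2)^{k+j}}{(n+m+k+j)(n-m+j+2)}\binom{n+m+k+j}{n+m-k-j}\binom{k+j}{j}=\frac{(-1)^{n+m}}{2(n+1)(n+m)}\sum_{k=0}^n(-1)^k\frac{\binom{n+m}{2k}}{\binom nk}.$$ In particular, for $n\ge1$, $$\sum_{j=0}^{n}\sum_{k=0}^{n-j}\frac{(-2)^{k+j}}{(n+k+j)(n+j+2)}\binom{n+k+j}{n-k-j}\binom{k+j}{j}=\frac{(-1)^n}{2n(n+1)}\sum_{k=0}^n(-1)^k\frac{\binom{n}{2k}}{\binom nk},$$ $$\sum_{j=0}^{2n}\sum_{k=0}^{2n-j}\frac{(-2)^{k+j}}{(2n+k+j)(j+2)}\binom{2n+k+j}{2n-k-j}\binom{k+j}{j}=\frac{1}{4n(n+1)}\sum_{k=0}^n(-1)^k\frac{\binom{2n}{2k}}{\binom nk}.$$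
   Context: Binomial coefficients $\binom{a}{b}$ with integers $0\le a<b$ are $0$. -}

module Defs where

open import Data.Fin.Base using (toℕ)
open import Data.Integer.Base as ℤ using (ℤ; +_; -[1+_])
open import Data.Nat.Base as ℕ using (ℕ; suc)
open import Data.Nat.Combinatorics using (_C_)
open import Data.Rational.Base as ℚ using (ℚ; 0ℚ)
open import Data.Rational.Properties using (+-0-commutativeMonoid)
open import Algebra.Properties.CommutativeMonoid.Sum +-0-commutativeMonoid using (sum)

-- The sum of f 0, f 1, …, f z, empty for negative z.
sumTo : ℤ → (ℕ → ℚ) → ℚ
sumTo (+ n)    f = sum {suc n} (λ i → f (toℕ i))
sumTo -[1+ _ ] f = 0ℚ

infixl 5 sumTo
syntax sumTo z (λ k → e) = ∑[ k ≤ z ] e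

-- The general integer binomial coefficient; a negative upper entry uses
-- binom (-a-1) b = (-1)^b binom (a+b) b.  For natural a < b, a C b is 0.
binom : ℤ → ℤ → ℤ
binom (+ a)    (+ b)    = + (a C b)
binom -[1+ a ] (+ b)    = (ℤ.- + 1) ℤ.^ b ℤ.* + ((a ℕ.+ b) C b)
binom _        -[1+ _ ] = + 0

infixl 7 _÷ᶻ_

-- The quotient of two integers as a rational number, made total by the
-- value 0 at denominator 0.
_÷ᶻ_ : ℤ → ℤ → ℚ
a ÷ᶻ (+ 0)      = 0ℚ
a ÷ᶻ (+ suc d)  = a ℚ./ suc d
a ÷ᶻ -[1+ d ]   = (ℤ.- a) ℚ./ suc d

{-# OPTIONS --safe #-}

-- Put N = n + m.  Since N/(N+i) binom(N+i, N-i) are the coefficients of the Chebyshev polynomial T_N(1 + y/2)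
-- in y, and Σ_j binom(i, j)/(n-m+2+j) = ∫₀¹ x^(n-m+1) (1+x)^i dx, taking y = -2(1+x) turns the left-hand side into
-- (-1)^N/N ∫₀¹ x^(n-m+1) T_N(x) dx.  On the other hand T_N = Σ_k binom(N, 2k) x^(N-2k) (x²-1)^k, and
-- ∫₀¹ x^(2(n-k)+1) (x²-1)^k dx = (-1)^k / (2(n+1) binom(n, k)) is a beta integral.
-- No integral is needed: a functional on polynomials is replaced by its moment sequence f a = ⟨x^a⟩, on which
-- multiplication by x acts as the shift a ↦ a + 1.
module Submission where

open import Data.Fin.Base using (toℕ)
import Data.Integer.Base as ℤ
import Data.Integer.Properties as ℤₚ
import Data.Integer.Solver
open import Data.Nat.Base as ℕ using (ℕ; zero; suc; z≤n; s≤s; _∸_; _!)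
open import Data.Nat.Combinatorics
  using (_C_; nCk≡n!/k![n-k]!; k![n∸k]!∣n!; k>n⇒nCk≡0; nCk≡nC[n∸k]; nCk+nC[k+1]≡[n+1]C[k+1])
open import Data.Nat.DivMod using (m/n*n≡m)
import Data.Nat.Properties as ℕₚ
import Data.Nat.Solver
open import Data.Product.Base using (_×_; _,_; ∃)
open import Data.Rational.Base as ℚ using (ℚ)
open import Data.Rational.Literals using (fromℤ)
import Data.Rational.Properties as ℚₚ
import Data.Rational.Solver
import Data.Rational.Unnormalised.Base as ℚᵘ
import Data.Rational.Unnormalised.Properties as ℚᵘₚ
open import Relation.Binary.PropositionalEquality
open import Relation.Nullary using (yes; no)
open import Algebra.Properties.CommutativeMonoid.Sum ℚₚ.+-0-commutativeMonoid using (sum)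
open import Defs
open ≡-Reasoning

module ℕS = Data.Nat.Solver.+-*-Solver
module ℚS = Data.Rational.Solver.+-*-Solver
module ℤS = Data.Integer.Solver.+-*-Solver

module ChebyshevMoments where

  open import Data.Rational.Base using (0ℚ; 1ℚ; _+_; _*_; _-_; -_; toℚᵘ)
  open ℚS using (solve; con; _:=_; _:+_; _:*_; _:-_; :-_)

  -- Embedding of the integers into the rationals, and reciprocals

  fromℤ-* : ∀ x y → fromℤ (x ℤ.* y) ≡ fromℤ x * fromℤ y
  fromℤ-* x y = ℚₚ.toℚᵘ-injective (ℚᵘₚ.≃-trans (ℚᵘ.*≡* refl) (ℚᵘₚ.≃-sym (ℚₚ.toℚᵘ-homo-* (fromℤ x) (fromℤ y))))

  fromℤ-+ : ∀ x y → fromℤ (x ℤ.+ y) ≡ fromℤ x + fromℤ y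
  fromℤ-+ x y = ℚₚ.toℚᵘ-injective (ℚᵘₚ.≃-trans
    (ℚᵘ.*≡* (cong (ℤ._* ℤ.+ 1) (sym (cong₂ ℤ._+_ (ℤₚ.*-identityʳ x) (ℤₚ.*-identityʳ y)))))
    (ℚᵘₚ.≃-sym (ℚₚ.toℚᵘ-homo-+ (fromℤ x) (fromℤ y))))

  ι : ℕ → ℚ
  ι n = fromℤ (ℤ.+ n)

  ι-+ : ∀ m n → ι (m ℕ.+ n) ≡ ι m + ι n
  ι-+ m n = fromℤ-+ (ℤ.+ m) (ℤ.+ n)

  ι-* : ∀ m n → ι (m ℕ.* n) ≡ ι m * ι n
  ι-* m n = trans (cong fromℤ (ℤₚ.pos-* m n)) (fromℤ-* (ℤ.+ m) (ℤ.+ n))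

  -- Inherits the value 0 at `d = 0` from `÷ᶻ`, so that `÷ᶻ-inv` and `inv-*` are true at zero as
  -- well.
  inv : ℕ → ℚ
  inv d = ℤ.+ 1 ÷ᶻ ℤ.+ d

  ÷ᶻ-inv : ∀ x d → x ÷ᶻ ℤ.+ d ≡ fromℤ x * inv d
  ÷ᶻ-inv x zero = sym (ℚₚ.*-zeroʳ (fromℤ x))
  ÷ᶻ-inv x (suc d) = ℚₚ.toℚᵘ-injective (ℚᵘₚ.≃-trans (ℚₚ.toℚᵘ-fromℚᵘ (ℚᵘ.mkℚᵘ x d))
    (ℚᵘₚ.≃-trans (ℚᵘ.*≡* cross) (ℚᵘₚ.≃-trans
      (ℚᵘₚ.*-congˡ {toℚᵘ (fromℤ x)} (ℚᵘₚ.≃-sym (ℚₚ.toℚᵘ-fromℚᵘ (ℚᵘ.mkℚᵘ (ℤ.+ 1) d))))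
      (ℚᵘₚ.≃-sym (ℚₚ.toℚᵘ-homo-* (fromℤ x) (inv (suc d)))))))
    where
    cross : x ℤ.* ℤ.+ (suc d ℕ.+ 0) ≡ x ℤ.* ℤ.+ 1 ℤ.* ℤ.+ suc d
    cross = cong₂ ℤ._*_ (sym (ℤₚ.*-identityʳ x)) (cong (λ e → ℤ.+ suc e) (ℕₚ.+-identityʳ d))

  ι-inv : ∀ d .{{_ : ℕ.NonZero d}} → ι d * inv d ≡ 1ℚ
  ι-inv (suc d) = trans (sym (÷ᶻ-inv (ℤ.+ suc d) (suc d)))
    (ℚₚ.fromℚᵘ-cong {ℚᵘ.mkℚᵘ (ℤ.+ suc d) d} {ℚᵘ.1ℚᵘ} (ℚᵘ.*≡* (ℤₚ.*-comm (ℤ.+ suc d) (ℤ.+ 1))))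

  inv-unique : ∀ d {x} → ι d * x ≡ 1ℚ → x ≡ inv d
  inv-unique zero {x} h with trans (sym h) (ℚₚ.*-zeroˡ x)
  ... | ()
  inv-unique (suc d) {x} h = begin
    x                                  ≡⟨ ℚₚ.*-identityʳ x ⟨
    x * 1ℚ                             ≡⟨ cong (x *_) (ι-inv (suc d)) ⟨
    x * (ι (suc d) * inv (suc d))
      ≡⟨ solve 3 (λ x d i → x :* (d :* i) := (d :* x) :* i) refl x (ι (suc d)) (inv (suc d)) ⟩
    (ι (suc d) * x) * inv (suc d)      ≡⟨ cong (_* inv (suc d)) h ⟩
    1ℚ * inv (suc d)                   ≡⟨ ℚₚ.*-identityˡ _ ⟩
    inv (suc d)                        ∎

  inv-* : ∀ m n → inv (m ℕ.* n) ≡ inv m * inv n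
  inv-* zero n = sym (ℚₚ.*-zeroˡ (inv n))
  inv-* (suc m) zero = trans (cong inv (ℕₚ.*-zeroʳ m)) (sym (ℚₚ.*-zeroʳ (inv (suc m))))
  inv-* (suc m) (suc n) = sym (inv-unique (suc m ℕ.* suc n) (begin
    ι (suc m ℕ.* suc n) * (x * y)     ≡⟨ cong (_* (x * y)) (ι-* (suc m) (suc n)) ⟩
    (ι (suc m) * ι (suc n)) * (x * y)
      ≡⟨ solve 4 (λ a b x y → (a :* b) :* (x :* y) := (a :* x) :* (b :* y)) refl (ι (suc m)) (ι (suc n)) x y ⟩
    (ι (suc m) * x) * (ι (suc n) * y) ≡⟨ cong₂ _*_ (ι-inv (suc m)) (ι-inv (suc n)) ⟩
    1ℚ * 1ℚ                           ∎))
    where x = inv (suc m) ; y = inv (suc n)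

  -- Finite sums

  Σ< : ℕ → (ℕ → ℚ) → ℚ
  Σ< n f = sum {n} (λ i → f (toℕ i))

  Σ-cong : ∀ n {f g} → (∀ i → i ℕ.< n → f i ≡ g i) → Σ< n f ≡ Σ< n g
  Σ-cong zero h = refl
  Σ-cong (suc n) h = cong₂ _+_ (h 0 (s≤s z≤n)) (Σ-cong n (λ i i<n → h (suc i) (s≤s i<n)))

  Σ-+ : ∀ n f g → Σ< n (λ i → f i + g i) ≡ Σ< n f + Σ< n g
  Σ-+ zero f g = refl
  Σ-+ (suc n) f g = trans (cong ((f 0 + g 0) +_) (Σ-+ n (λ i → f (suc i)) (λ i → g (suc i))))
    (solve 4 (λ a b c d → (a :+ b) :+ (c :+ d) := (a :+ c) :+ (b :+ d)) refl
         (f 0) (g 0) (Σ< n (λ i → f (suc i))) (Σ< n (λ i → g (suc i))))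

  Σ-* : ∀ n c f → Σ< n (λ i → c * f i) ≡ c * Σ< n f
  Σ-* zero c f = sym (ℚₚ.*-zeroʳ c)
  Σ-* (suc n) c f = trans (cong (c * f 0 +_) (Σ-* n c (λ i → f (suc i)))) (sym (ℚₚ.*-distribˡ-+ c (f 0) _))

  Σ-snoc : ∀ n f → Σ< (suc n) f ≡ Σ< n f + f n
  Σ-snoc zero f = ℚₚ.+-comm (f 0) 0ℚ
  Σ-snoc (suc n) f = trans (cong (f 0 +_) (Σ-snoc n (λ i → f (suc i)))) (sym (ℚₚ.+-assoc (f 0) _ _))

  Σ-snoc-0 : ∀ n f → f n ≡ 0ℚ → Σ< (suc n) f ≡ Σ< n f
  Σ-snoc-0 n f h = trans (Σ-snoc n f) (trans (cong (Σ< n f +_) h) (ℚₚ.+-identityʳ _))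

  Σ-zero : ∀ n f → (∀ i → f i ≡ 0ℚ) → Σ< n f ≡ 0ℚ
  Σ-zero zero f h = refl
  Σ-zero (suc n) f h = trans (cong₂ _+_ (h 0) (Σ-zero n _ (λ i → h (suc i)))) refl

  -- Resummation of a triangle along its antidiagonals i = k + j. The induction splits off the
  -- column j = 0; the other columns form a smaller triangle.
  Σ-triangle : ∀ n (h : ℕ → ℕ → ℚ) →
    Σ< n (λ j → Σ< (n ∸ j) (λ k → h k j)) ≡ Σ< n (λ i → Σ< (suc i) (λ j → h (i ∸ j) j))
  Σ-triangle zero h = refl
  Σ-triangle (suc n) h = begin
    Σ< (suc n) (λ k → h k 0) + Σ< n (λ j → Σ< (n ∸ j) (λ k → h k (suc j)))
      ≡⟨ cong (Σ< (suc n) (λ k → h k 0) +_) (Σ-triangle n (λ k j → h k (suc j))) ⟩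
    Σ< (suc n) (λ k → h k 0) + Σ< n (λ i → Σ< (suc i) (λ j → h (i ∸ j) (suc j)))
      -- The new diagonal i = 0 is an empty sum, equal to `0ℚ`; with it both outer sums have the
      -- same range and can be merged.
      ≡⟨ cong (Σ< (suc n) (λ k → h k 0) +_) (ℚₚ.+-identityˡ _) ⟨
    Σ< (suc n) (λ k → h k 0) + Σ< (suc n) (λ i → Σ< i (λ j → h (i ∸ suc j) (suc j)))
      ≡⟨ Σ-+ (suc n) (λ k → h k 0) (λ i → Σ< i (λ j → h (i ∸ suc j) (suc j))) ⟨
    Σ< (suc n) (λ i → Σ< (suc i) (λ j → h (i ∸ j) j)) ∎

  -- Identities for binomial coefficients

  C-factorial : ∀ r k → ((r ℕ.+ k) C k) ℕ.* (k ! ℕ.* r !) ≡ (r ℕ.+ k) !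
  C-factorial r k = begin
    ((r ℕ.+ k) C k) ℕ.* (k ! ℕ.* r !)
      ≡⟨ cong (λ s → ((r ℕ.+ k) C k) ℕ.* (k ! ℕ.* s !)) (ℕₚ.m+n∸n≡m r k) ⟨
    ((r ℕ.+ k) C k) ℕ.* (k ! ℕ.* (r ℕ.+ k ∸ k) !)
      ≡⟨ cong (ℕ._* (k ! ℕ.* (r ℕ.+ k ∸ k) !)) (nCk≡n!/k![n-k]! k≤r+k) ⟩
    _ ≡⟨ m/n*n≡m {{k ℕₚ.!* (r ℕ.+ k ∸ k) !≢0}} (k![n∸k]!∣n! k≤r+k) ⟩
    (r ℕ.+ k) ! ∎
    where k≤r+k = ℕₚ.m≤n+m k r

  -- With n = r + k this is n binom(n-1, k) = (n-k) binom(n, k); for r > 0 it follows by comparing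
  -- both sides with n!. The subtraction truncates only at n = 0, where both sides are 0.
  C-absorb : ∀ r k → (r ℕ.+ k) ℕ.* ((r ℕ.+ k ∸ 1) C k) ≡ r ℕ.* ((r ℕ.+ k) C k)
  C-absorb zero zero = refl
  C-absorb zero (suc k) = trans (cong (suc k ℕ.*_) (k>n⇒nCk≡0 (ℕₚ.n<1+n k))) (ℕₚ.*-zeroʳ (suc k))
  C-absorb (suc r) k = ℕₚ.*-cancelʳ-≡ _ _ (k ! ℕ.* r !) {{k ℕₚ.!* r !≢0}} (begin
    suc (r ℕ.+ k) ℕ.* ((r ℕ.+ k) C k) ℕ.* (k ! ℕ.* r !)
      ≡⟨ ℕₚ.*-assoc (suc (r ℕ.+ k)) ((r ℕ.+ k) C k) (k ! ℕ.* r !) ⟩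
    suc (r ℕ.+ k) ℕ.* (((r ℕ.+ k) C k) ℕ.* (k ! ℕ.* r !)) ≡⟨ cong (suc (r ℕ.+ k) ℕ.*_) (C-factorial r k) ⟩
    suc (r ℕ.+ k) !                                     ≡⟨ C-factorial (suc r) k ⟨
    c ℕ.* (k ! ℕ.* (suc r ℕ.* r !))
      ≡⟨ ℕS.solve 4 (λ c a s b → c ℕS.:* (a ℕS.:* (s ℕS.:* b)) ℕS.:= s ℕS.:* c ℕS.:* (a ℕS.:* b)) refl
           c (k !) (suc r) (r !) ⟩
    suc r ℕ.* c ℕ.* (k ! ℕ.* r !)                       ∎)
    where c = suc (r ℕ.+ k) C k

  -- The second difference of binom(-, k+2) at n is binom(n, k), by Pascal's rule. This one identity
  -- drives both coefficient recurrences, `V-rec` and `P-rec`.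
  C-step : ∀ n k → (2 ℕ.+ n) C (2 ℕ.+ k) ℕ.+ n C (2 ℕ.+ k) ≡ 2 ℕ.* ((1 ℕ.+ n) C (2 ℕ.+ k)) ℕ.+ n C k
  C-step n k
    rewrite sym (nCk+nC[k+1]≡[n+1]C[k+1] (suc n) (suc k))
          | sym (nCk+nC[k+1]≡[n+1]C[k+1] n (suc k))
          | sym (nCk+nC[k+1]≡[n+1]C[k+1] n k)
    = ℕS.solve 3 (λ a b c → (a ℕS.:+ b) ℕS.:+ (b ℕS.:+ c) ℕS.:+ c ℕS.:= ℕS.con 2 ℕS.:* (b ℕS.:+ c) ℕS.:+ a) refl
         (n C k) (n C suc k) (n C (2 ℕ.+ k))

  ι-C-step : ∀ n k → ι ((2 ℕ.+ n) C (2 ℕ.+ k)) + ι (n C (2 ℕ.+ k)) ≡ ι 2 * ι ((1 ℕ.+ n) C (2 ℕ.+ k)) + ι (n C k)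
  ι-C-step n k = begin
    ι ((2 ℕ.+ n) C (2 ℕ.+ k)) + ι (n C (2 ℕ.+ k)) ≡⟨ ι-+ ((2 ℕ.+ n) C (2 ℕ.+ k)) (n C (2 ℕ.+ k)) ⟨
    ι ((2 ℕ.+ n) C (2 ℕ.+ k) ℕ.+ n C (2 ℕ.+ k))   ≡⟨ cong ι (C-step n k) ⟩
    ι (2 ℕ.* c ℕ.+ n C k)                         ≡⟨ ι-+ (2 ℕ.* c) (n C k) ⟩
    ι (2 ℕ.* c) + ι (n C k)                       ≡⟨ cong (_+ ι (n C k)) (ι-* 2 c) ⟩
    ι 2 * ι c + ι (n C k)                         ∎
    where c = (1 ℕ.+ n) C (2 ℕ.+ k)

  -- The coefficient 2N/(N+i) binom(N+i, 2i) of 2 T_N(1 + y/2) splits into binom(N+i, 2i) +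
  -- binom(N+i-1, 2i), the coefficients of two consecutive third-kind polynomials. With N = i + r
  -- this is `C-absorb` at k = 2i.
  C-chebyshev : ∀ i N → i ℕ.≤ N →
    (N ℕ.+ i) ℕ.* ((i ℕ.+ N) C (i ℕ.* 2) ℕ.+ (i ℕ.+ N ∸ 1) C (i ℕ.* 2)) ≡ (2 ℕ.* N) ℕ.* ((i ℕ.+ N) C (i ℕ.* 2))
  C-chebyshev i N i≤N with ℕₚ.m≤n⇒∃[o]m+o≡n i≤N
  ... | r , refl
    rewrite ℕS.solve 2 (λ i r → i ℕS.:+ (i ℕS.:+ r) ℕS.:= r ℕS.:+ i ℕS.:* ℕS.con 2) refl i r
          | ℕS.solve 2 (λ i r → (i ℕS.:+ r) ℕS.:+ i ℕS.:= r ℕS.:+ i ℕS.:* ℕS.con 2) refl i r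
    = begin
    (r ℕ.+ k) ℕ.* (c ℕ.+ (r ℕ.+ k ∸ 1) C k)             ≡⟨ ℕₚ.*-distribˡ-+ (r ℕ.+ k) c _ ⟩
    (r ℕ.+ k) ℕ.* c ℕ.+ (r ℕ.+ k) ℕ.* ((r ℕ.+ k ∸ 1) C k) ≡⟨ cong ((r ℕ.+ k) ℕ.* c ℕ.+_) (C-absorb r k) ⟩
    (r ℕ.+ k) ℕ.* c ℕ.+ r ℕ.* c
      ≡⟨ ℕS.solve 3 (λ i r c → (r ℕS.:+ i ℕS.:* ℕS.con 2) ℕS.:* c ℕS.:+ r ℕS.:* c
           ℕS.:= (ℕS.con 2 ℕS.:* (i ℕS.:+ r)) ℕS.:* c) refl i r c ⟩
    (2 ℕ.* (i ℕ.+ r)) ℕ.* c ∎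
    where
    k = i ℕ.* 2
    c = (r ℕ.+ k) C k

  inv-cross : ∀ a b .{{_ : ℕ.NonZero a}} .{{_ : ℕ.NonZero b}} c d → a ℕ.* c ≡ b ℕ.* d → inv b * ι c ≡ inv a * ι d
  inv-cross a b c d ac≡bd = begin
    inv b * ι c                      ≡⟨ ℚₚ.*-identityˡ (inv b * ι c) ⟨
    1ℚ * (inv b * ι c)               ≡⟨ cong (_* (inv b * ι c)) (ι-inv a) ⟨
    (ι a * inv a) * (inv b * ι c)
      ≡⟨ solve 4 (λ a a' b' c → (a :* a') :* (b' :* c) := (a :* c) :* (a' :* b')) refl
           (ι a) (inv a) (inv b) (ι c) ⟩
    (ι a * ι c) * (inv a * inv b)
      ≡⟨ cong (_* (inv a * inv b)) (trans (sym (ι-* a c)) (trans (cong ι ac≡bd) (ι-* b d))) ⟩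
    (ι b * ι d) * (inv a * inv b)
      ≡⟨ solve 4 (λ b d a' b' → (b :* d) :* (a' :* b') := (b :* b') :* (a' :* d)) refl
           (ι b) (ι d) (inv a) (inv b) ⟩
    (ι b * inv b) * (inv a * ι d)    ≡⟨ cong (_* (inv a * ι d)) (ι-inv b) ⟩
    1ℚ * (inv a * ι d)               ≡⟨ ℚₚ.*-identityˡ (inv a * ι d) ⟩
    inv a * ι d                      ∎

  -- Polynomials acting on a moment sequence

  -- For a moment sequence f, the values at a of W f i, D f k and T f N are ⟨x^a (1+x)^i⟩, ⟨x^a (x²-1)^k⟩ and
  -- ⟨x^a T_N(x)⟩.
  W : (ℕ → ℚ) → ℕ → ℕ → ℚ
  W f zero    a = f a
  W f (suc i) a = W f i a + W f i (suc a)

  D : (ℕ → ℚ) → ℕ → ℕ → ℚ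
  D f zero    a = f a
  D f (suc k) a = D f k (2 ℕ.+ a) - D f k a

  T : (ℕ → ℚ) → ℕ → ℕ → ℚ
  T f 0             a = f a
  T f 1             a = f (suc a)
  T f (suc (suc N)) a = ι 2 * T f (suc N) (suc a) - T f N a

  -- The binomial theorem for (1+x)^i, by Pascal's rule.
  W-sum : ∀ f i a → W f i a ≡ Σ< (suc i) (λ j → ι (i C j) * f (j ℕ.+ a))
  W-sum f zero a = solve 1 (λ x → x := con 1ℚ :* x :+ con 0ℚ) refl (f a)
  W-sum f (suc i) a = begin
    W f i a + W f i (suc a)            ≡⟨ cong₂ _+_ (W-sum f i a) (W-sum f i (suc a)) ⟩
    -- The appended term at j = i + 1 is zero; it allows the term j = 0 to be split off so that the
    -- rest aligns with `u`.
    Σ< (suc i) (t 0) + Σ< (suc i) u    ≡⟨ cong (_+ Σ< (suc i) u) (Σ-snoc-0 (suc i) (t 0) last) ⟨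
    (t 0 0 + Σ< (suc i) (t 1)) + Σ< (suc i) u
      ≡⟨ solve 3 (λ x y z → (x :+ y) :+ z := x :+ (z :+ y)) refl (t 0 0) (Σ< (suc i) (t 1)) (Σ< (suc i) u) ⟩
    t 0 0 + (Σ< (suc i) u + Σ< (suc i) (t 1)) ≡⟨ cong (t 0 0 +_) (Σ-+ (suc i) u (t 1)) ⟨
    t 0 0 + Σ< (suc i) (λ j → u j + t 1 j)    ≡⟨ cong (t 0 0 +_) (Σ-cong (suc i) (λ j _ → pascal j)) ⟩
    Σ< (2 ℕ.+ i) (λ j → ι (suc i C j) * f (j ℕ.+ a)) ∎
    where
    t : ℕ → ℕ → ℚ
    t s j = ι (i C (s ℕ.+ j)) * f (s ℕ.+ j ℕ.+ a)
    u : ℕ → ℚ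
    u j = ι (i C j) * f (j ℕ.+ suc a)
    last : t 0 (suc i) ≡ 0ℚ
    last = trans (cong (λ c → ι c * f (suc i ℕ.+ a)) (k>n⇒nCk≡0 (ℕₚ.n<1+n i))) (ℚₚ.*-zeroˡ (f (suc i ℕ.+ a)))
    pascal : ∀ j → u j + t 1 j ≡ ι (suc i C suc j) * f (suc j ℕ.+ a)
    pascal j = begin
      ι (i C j) * f (j ℕ.+ suc a) + t 1 j  ≡⟨ cong (λ s → ι (i C j) * f s + t 1 j) (ℕₚ.+-suc j a) ⟩
      ι (i C j) * x + ι (i C suc j) * x    ≡⟨ ℚₚ.*-distribʳ-+ x (ι (i C j)) (ι (i C suc j)) ⟨
      (ι (i C j) + ι (i C suc j)) * x      ≡⟨ cong (_* x) (ι-+ (i C j) (i C suc j)) ⟨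
      ι (i C j ℕ.+ i C suc j) * x          ≡⟨ cong (λ c → ι c * x) (nCk+nC[k+1]≡[n+1]C[k+1] i j) ⟩
      ι (suc i C suc j) * x                ∎
      where x = f (suc j ℕ.+ a)

  -- Chebyshev polynomials of the third kind

  sgn : ℕ → ℚ
  sgn n = fromℤ ((ℤ.- ℤ.+ 1) ℤ.^ n)

  sgn-suc : ∀ n → sgn (suc n) ≡ - sgn n
  sgn-suc n = trans (fromℤ-* (ℤ.- ℤ.+ 1) ((ℤ.- ℤ.+ 1) ℤ.^ n))
    (solve 1 (λ x → con (fromℤ (ℤ.- ℤ.+ 1)) :* x := :- x) refl (sgn n))

  pow-2 : ℕ → ℚ
  pow-2 n = fromℤ ((ℤ.- ℤ.+ 2) ℤ.^ n)

  -- Up to truncation at K, V f K N a is ⟨x^a V_{N-1}(-x)⟩ for the Chebyshev polynomials of the third kind,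
  -- extended to index -1 by the recurrence; i + N ∸ 1 truncates only for i = N = 0, where vCoeff is still 1.
  vCoeff : ℕ → ℕ → ℕ
  vCoeff N i = (i ℕ.+ N ∸ 1) C (i ℕ.* 2)

  V : (ℕ → ℚ) → ℕ → ℕ → ℕ → ℚ
  V f K N a = Σ< (suc K) (λ i → ι (vCoeff N i) * (pow-2 i * W f i a))

  i<i*2 : ∀ i → suc i ℕ.< suc i ℕ.* 2
  i<i*2 i = s≤s (s≤s (ℕₚ.m≤m*n i 2))

  C-vanish : ∀ {n k} x → n ℕ.< k → ι (n C k) * x ≡ 0ℚ
  C-vanish x n<k = trans (cong (λ c → ι c * x) (k>n⇒nCk≡0 n<k)) (ℚₚ.*-zeroˡ x)

  V-0 : ∀ f K a → V f K 0 a ≡ f a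
  V-0 f K a = trans
    (cong (ι 1 * (pow-2 0 * f a) +_) (Σ-zero K
      (λ i → ι (vCoeff 0 (suc i)) * (pow-2 (suc i) * W f (suc i) a))
      (λ i → C-vanish (pow-2 (suc i) * W f (suc i) a)
      (ℕₚ.<-trans (s≤s (ℕₚ.≤-reflexive (ℕₚ.+-identityʳ i))) (i<i*2 i)))))
    (solve 1 (λ x → con 1ℚ :* (con 1ℚ :* x) :+ con 0ℚ := x) refl (f a))

  V-1 : ∀ f K a → V f K 1 a ≡ f a
  V-1 f K a = trans
    (cong (ι 1 * (pow-2 0 * f a) +_) (Σ-zero K
      (λ i → ι (vCoeff 1 (suc i)) * (pow-2 (suc i) * W f (suc i) a))
      (λ i → C-vanish (pow-2 (suc i) * W f (suc i) a)
      (ℕₚ.≤-<-trans (ℕₚ.≤-reflexive (ℕₚ.+-comm i 1)) (i<i*2 i)))))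
    (solve 1 (λ x → con 1ℚ :* (con 1ℚ :* x) :+ con 0ℚ := x) refl (f a))

  -- The bound K need not grow with N: for N < K the summand of V f K (1 + N) at i = K vanishes.
  V-rec : ∀ f K N a → N ℕ.< K → V f K (2 ℕ.+ N) a + V f K N a ≡ - (ι 2 * V f K (1 ℕ.+ N) (suc a))
  V-rec f K N a N<K = begin
    (z + Σ< K (t (2 ℕ.+ N))) + (z + Σ< K (t N))
      ≡⟨ solve 3 (λ z x y → (z :+ x) :+ (z :+ y) := z :+ z :+ (x :+ y)) refl
           z (Σ< K (t (2 ℕ.+ N))) (Σ< K (t N)) ⟩
    z + z + (Σ< K (t (2 ℕ.+ N)) + Σ< K (t N))         ≡⟨ cong (λ x → z + z + x) (Σ-+ K (t (2 ℕ.+ N)) (t N)) ⟨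
    -- Coefficientwise, the recurrence multiplies by 2 + y: the factor 2 keeps the index, and `v` is
    -- the product with y. Since y = -2(1+x), the factor 2 + y is -2x.
    z + z + Σ< K (λ i → t (2 ℕ.+ N) i + t N i)        ≡⟨ cong (λ x → z + z + x) (Σ-cong K (λ i _ → term i)) ⟩
    z + z + Σ< K (λ i → ι 2 * t (1 ℕ.+ N) i + v i)
      ≡⟨ cong (λ x → z + z + x) (Σ-+ K (λ i → ι 2 * t (1 ℕ.+ N) i) v) ⟩
    z + z + (Σ< K (λ i → ι 2 * t (1 ℕ.+ N) i) + Σ< K v)
      ≡⟨ cong₂ (λ x y → z + z + (x + y)) (Σ-* K (ι 2) (t (1 ℕ.+ N))) Σv ⟩
    z + z + (ι 2 * Σ< K (t (1 ℕ.+ N)) + - ι 2 * (z + Σ< K (t (1 ℕ.+ N)) + V f K (1 ℕ.+ N) (suc a)))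
      ≡⟨ solve 3 (λ z s u → z :+ z :+ (con (ι 2) :* s :+ (:- con (ι 2)) :* (z :+ s :+ u)) := :- (con (ι 2) :* u)) refl
           z (Σ< K (t (1 ℕ.+ N))) (V f K (1 ℕ.+ N) (suc a)) ⟩
    - (ι 2 * V f K (1 ℕ.+ N) (suc a)) ∎
    where
    z : ℚ
    z = ι 1 * (pow-2 0 * f a)
    x : ℕ → ℕ → ℚ
    x i b = pow-2 i * W f i b
    t : ℕ → ℕ → ℚ
    t M i = ι (vCoeff M (suc i)) * x (suc i) a
    c : ℕ → ℚ
    c i = ι (vCoeff (1 ℕ.+ N) i)
    v : ℕ → ℚ
    v i = c i * x (suc i) a
    -- Here `x i b` is ⟨x^b y^i⟩, and one factor y is replaced by -2(1+x).
    x-suc : ∀ i → x (suc i) a ≡ - ι 2 * (x i a + x i (suc a))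
    x-suc i = trans (cong (_* W f (suc i) a) (fromℤ-* (ℤ.- ℤ.+ 2) ((ℤ.- ℤ.+ 2) ℤ.^ i)))
      (solve 3 (λ p y z → (:- con (ι 2)) :* p :* (y :+ z) := (:- con (ι 2)) :* (p :* y :+ p :* z)) refl
           (pow-2 i) (W f i a) (W f i (suc a)))
    Σv : Σ< K v ≡ - ι 2 * (V f K (1 ℕ.+ N) a + V f K (1 ℕ.+ N) (suc a))
    Σv = begin
      Σ< K v ≡⟨ Σ-cong K (λ i _ → trans (cong (c i *_) (x-suc i))
             (solve 3 (λ c y z → c :* ((:- con (ι 2)) :* (y :+ z)) := (:- con (ι 2)) :* (c :* y :+ c :* z)) refl
                  (c i) (x i a) (x i (suc a)))) ⟩
      Σ< K (λ i → - ι 2 * (c i * x i a + c i * x i (suc a)))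
        ≡⟨ Σ-* K (- ι 2) (λ i → c i * x i a + c i * x i (suc a)) ⟩
      - ι 2 * Σ< K (λ i → c i * x i a + c i * x i (suc a))
        ≡⟨ cong (- ι 2 *_) (Σ-+ K (λ i → c i * x i a) (λ i → c i * x i (suc a))) ⟩
      - ι 2 * (Σ< K (λ i → c i * x i a) + Σ< K (λ i → c i * x i (suc a)))
        ≡⟨ cong (- ι 2 *_) (cong₂ _+_ (top a) (top (suc a))) ⟨
      - ι 2 * (V f K (1 ℕ.+ N) a + V f K (1 ℕ.+ N) (suc a)) ∎
      where
      K+N<K*2 : K ℕ.+ (1 ℕ.+ N) ∸ 1 ℕ.< K ℕ.* 2
      K+N<K*2 = subst₂ ℕ._<_ (sym (cong (_∸ 1) (ℕₚ.+-suc K N)))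
        (ℕS.solve 1 (λ k → k ℕS.:+ k ℕS.:= k ℕS.:* ℕS.con 2) refl K)
        (ℕₚ.+-monoʳ-< K N<K)
      top : ∀ b → V f K (1 ℕ.+ N) b ≡ Σ< K (λ i → c i * x i b)
      top b = Σ-snoc-0 K (λ i → c i * x i b) (C-vanish (x K b) K+N<K*2)
    term : ∀ i → t (2 ℕ.+ N) i + t N i ≡ ι 2 * t (1 ℕ.+ N) i + v i
    term i = begin
      t (2 ℕ.+ N) i + t N i
        ≡⟨ ℚₚ.*-distribʳ-+ y (ι (vCoeff (2 ℕ.+ N) (suc i))) (ι (vCoeff N (suc i))) ⟨
      (ι (vCoeff (2 ℕ.+ N) (suc i)) + ι (vCoeff N (suc i))) * y ≡⟨ cong (_* y) coeffs ⟩
      (ι 2 * ι (vCoeff (1 ℕ.+ N) (suc i)) + c i) * y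
        ≡⟨ solve 3 (λ a b y → (con (ι 2) :* a :+ b) :* y := con (ι 2) :* (a :* y) :+ b :* y) refl
             (ι (vCoeff (1 ℕ.+ N) (suc i))) (c i) y ⟩
      ι 2 * t (1 ℕ.+ N) i + v i         ∎
      where
      y = x (suc i) a
      coeffs : ι (vCoeff (2 ℕ.+ N) (suc i)) + ι (vCoeff N (suc i)) ≡ ι 2 * ι (vCoeff (1 ℕ.+ N) (suc i)) + c i
      coeffs rewrite ℕₚ.+-suc i (suc N) | ℕₚ.+-suc i N = ι-C-step (i ℕ.+ N) (i ℕ.* 2)

  -- The relation V_N + V_{N-1} = 2 T_N at -x, combined with T_N(-x) = (-1)^N T_N(x). Two
  -- consecutive instances of `V-rec`, added, give the left-hand side the recurrence of T_N(-x).
  V+V≡2T : ∀ f K N a → N ℕ.≤ K → V f K (1 ℕ.+ N) a + V f K N a ≡ ι 2 * (sgn N * T f N a)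
  V+V≡2T f K 0 a _ = trans (cong₂ _+_ (V-1 f K a) (V-0 f K a))
    (solve 1 (λ x → x :+ x := con (ι 2) :* (con 1ℚ :* x)) refl (f a))
  -- The polynomials of index 0 and -1 are both 1, so `V f K 1 a` can be exchanged for `V f K 0 a`,
  -- which is what `V-rec` requires.
  V+V≡2T f K 1 a 1≤K = trans (cong (V f K 2 a +_) (trans (V-1 f K a) (sym (V-0 f K a))))
    (trans (V-rec f K 0 a 1≤K) (trans (cong (λ x → - (ι 2 * x)) (V-1 f K (suc a)))
      (solve 1 (λ x → :- (con (ι 2) :* x) := con (ι 2) :* (con (- 1ℚ) :* x)) refl (f (suc a)))))
  V+V≡2T f K (suc (suc N)) a N+2≤K = begin
    u 3 + u 2
      ≡⟨ solve 4 (λ a b c d → a :+ b := (a :+ c) :+ (b :+ d) :- (c :+ d)) refl (u 3) (u 2) (u 1) (u 0) ⟩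
    (u 3 + u 1) + (u 2 + u 0) - (u 1 + u 0)
      ≡⟨ cong₂ _-_ (cong₂ _+_ (V-rec f K (suc N) a N+2≤K) (V-rec f K N a (ℕₚ.<-trans (ℕₚ.n<1+n N) N+2≤K)))
                   (V+V≡2T f K N a (ℕₚ.≤-trans (ℕₚ.m≤n+m N 2) N+2≤K)) ⟩
    - (ι 2 * u′ 2) + - (ι 2 * u′ 1) - ι 2 * (s * y)
      ≡⟨ solve 4 (λ a b s y → :- (con (ι 2) :* a) :+ :- (con (ι 2) :* b) :- con (ι 2) :* (s :* y)
           := :- (con (ι 2) :* (a :+ b)) :- con (ι 2) :* (s :* y)) refl (u′ 2) (u′ 1) s y ⟩
    - (ι 2 * (u′ 2 + u′ 1)) - ι 2 * (s * y)
      ≡⟨ cong (λ w → - (ι 2 * w) - ι 2 * (s * y)) (trans (V+V≡2T f K (suc N) (suc a) (ℕₚ.<⇒≤ N+2≤K))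
           (cong (λ s → ι 2 * (s * x)) (sgn-suc N))) ⟩
    - (ι 2 * (ι 2 * (- s * x))) - ι 2 * (s * y)
      ≡⟨ solve 3 (λ s x y → :- (con (ι 2) :* (con (ι 2) :* (:- s :* x))) :- con (ι 2) :* (s :* y)
           := con (ι 2) :* (:- (:- s) :* (con (ι 2) :* x :- y))) refl s x y ⟩
    ι 2 * (- - s * (ι 2 * x - y))
      ≡⟨ cong (λ s → ι 2 * (s * (ι 2 * x - y))) (trans (sgn-suc (suc N)) (cong -_ (sgn-suc N))) ⟨
    ι 2 * (sgn (2 ℕ.+ N) * T f (2 ℕ.+ N) a) ∎
    where
    u u′ : ℕ → ℚ
    u M = V f K (M ℕ.+ N) a
    u′ M = V f K (M ℕ.+ N) (suc a)
    s = sgn N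
    x = T f (suc N) (suc a)
    y = T f N a

  -- Expansion of T_N in powers of x and x² - 1

  ∸-suc : ∀ {m N} → m ℕ.< N → suc (N ∸ suc m) ≡ N ∸ m
  ∸-suc {zero}  {suc N} _         = refl
  ∸-suc {suc m} {suc N} (s≤s m<N) = ∸-suc m<N

  -- N ∸ k * 2 truncates only where the binomial coefficient vanishes.
  P : (ℕ → ℚ) → ℕ → ℕ → ℕ → ℚ
  P f K N a = Σ< (suc K) (λ k → ι (N C (k ℕ.* 2)) * D f k (N ∸ k ℕ.* 2 ℕ.+ a))

  -- Lets exponents with truncated subtraction be rewritten under a binomial coefficient: outside k
  -- ≤ n the coefficient vanishes.
  C-guard : ∀ n k {x y} → (k ℕ.≤ n → x ≡ y) → ι (n C k) * x ≡ ι (n C k) * y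
  C-guard n k {x} {y} h with k ℕₚ.≤? n
  ... | yes k≤n = cong (ι (n C k) *_) (h k≤n)
  ... | no  k≰n = trans (C-vanish x (ℕₚ.≰⇒> k≰n)) (sym (C-vanish y (ℕₚ.≰⇒> k≰n)))

  -- Coefficientwise, `C-step` says P_{N+2} + x² P_N = 2x P_{N+1} + (x²-1) P_N, and x² P_N cancels.
  -- The bound on N gives binom(N, 2K) = 0, so multiplying P_N by x² - 1 creates no term beyond the
  -- truncation.
  P-rec : ∀ f K N a → N ℕ.< K ℕ.* 2 → P f K (2 ℕ.+ N) a ≡ ι 2 * P f K (1 ℕ.+ N) (suc a) - P f K N a
  P-rec f K N a N<2K = begin
    z + Σ< K t₂
      ≡⟨ solve 4 (λ z t₂ t₀ s → z :+ t₂ := (t₂ :+ t₀) :+ z :- t₀) refl z (Σ< K t₂) (Σ< K t₀) (P f K N a) ⟩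
    Σ< K t₂ + Σ< K t₀ + z - Σ< K t₀
      ≡⟨ cong (λ s → s + z - Σ< K t₀) (trans (sym (Σ-+ K t₂ t₀))
           (trans (Σ-cong K (λ k _ → term k))
           (trans (Σ-+ K (λ k → ι 2 * t₁ k) w) (cong₂ _+_ (Σ-* K (ι 2) t₁) Σw)))) ⟩
    ι 2 * Σ< K t₁ + (z + Σ< K t₀ + - 1ℚ * P f K N a) + z - Σ< K t₀
      ≡⟨ solve 4 (λ z t₁ t₀ s → con (ι 2) :* t₁ :+ (z :+ t₀ :+ con (- 1ℚ) :* s) :+ z :- t₀
           := con (ι 2) :* (z :+ t₁) :- s) refl z (Σ< K t₁) (Σ< K t₀) (P f K N a) ⟩
    ι 2 * (z + Σ< K t₁) - P f K N a
      ≡⟨ cong (λ x → ι 2 * x - P f K N a) (cong₂ _+_ (cong (λ b → ι 1 * f b) (sym (ℕₚ.+-suc (suc N) a)))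
           (Σ-cong K (λ k _ → t₁-index k))) ⟩
    ι 2 * P f K (1 ℕ.+ N) (suc a) - P f K N a ∎
    where
    x : ℕ → ℚ
    x k = D f (suc k) (N ∸ k ℕ.* 2 ℕ.+ a)
    z : ℚ
    z = ι 1 * f (2 ℕ.+ N ℕ.+ a)
    t₀ t₁ t₂ w : ℕ → ℚ
    t₀ k = ι (N C (suc k ℕ.* 2)) * D f (suc k) (2 ℕ.+ (N ∸ suc k ℕ.* 2 ℕ.+ a))
    t₁ k = ι ((1 ℕ.+ N) C (suc k ℕ.* 2)) * x k
    t₂ k = ι ((2 ℕ.+ N) C (suc k ℕ.* 2)) * x k
    w k = ι (N C (k ℕ.* 2)) * x k
    t₁-index : ∀ k → t₁ k ≡ ι ((1 ℕ.+ N) C (suc k ℕ.* 2)) * D f (suc k) (1 ℕ.+ N ∸ suc k ℕ.* 2 ℕ.+ suc a)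
    t₁-index k = C-guard (1 ℕ.+ N) (suc k ℕ.* 2) (λ { (s≤s 1+2k≤N) →
      cong (D f (suc k)) (trans (cong (ℕ._+ a) (sym (∸-suc 1+2k≤N))) (sym (ℕₚ.+-suc (N ∸ suc (k ℕ.* 2)) a))) })
    t₀-index : ∀ k → t₀ k ≡ ι (N C (suc k ℕ.* 2)) * x k
    t₀-index k = C-guard N (suc k ℕ.* 2) (λ 2+2k≤N →
      cong (λ b → D f (suc k) (b ℕ.+ a)) (trans (cong suc (∸-suc 2+2k≤N)) (∸-suc (ℕₚ.<-trans (ℕₚ.n<1+n _) 2+2k≤N))))
    term : ∀ k → t₂ k + t₀ k ≡ ι 2 * t₁ k + w k
    term k = begin
      t₂ k + t₀ k                   ≡⟨ cong (t₂ k +_) (t₀-index k) ⟩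
      t₂ k + ι (N C (suc k ℕ.* 2)) * x k
        ≡⟨ ℚₚ.*-distribʳ-+ (x k) (ι ((2 ℕ.+ N) C (suc k ℕ.* 2))) (ι (N C (suc k ℕ.* 2))) ⟨
      (ι ((2 ℕ.+ N) C (suc k ℕ.* 2)) + ι (N C (suc k ℕ.* 2))) * x k ≡⟨ cong (_* x k) (ι-C-step N (k ℕ.* 2)) ⟩
      (ι 2 * ι ((1 ℕ.+ N) C (suc k ℕ.* 2)) + ι (N C (k ℕ.* 2))) * x k
        ≡⟨ solve 3 (λ a b y → (con (ι 2) :* a :+ b) :* y := con (ι 2) :* (a :* y) :+ b :* y) refl
             (ι ((1 ℕ.+ N) C (suc k ℕ.* 2))) (ι (N C (k ℕ.* 2))) (x k) ⟩
      ι 2 * t₁ k + w k ∎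
    Σw : Σ< K w ≡ z + Σ< K t₀ + - 1ℚ * P f K N a
    Σw = begin
      Σ< K w
        ≡⟨ Σ-cong K (λ k _ → solve 3 (λ c x y → c :* (x :- y) := c :* x :+ con (- 1ℚ) :* (c :* y)) refl
             (ι (N C (k ℕ.* 2))) (D f k (2 ℕ.+ (N ∸ k ℕ.* 2 ℕ.+ a))) (D f k (N ∸ k ℕ.* 2 ℕ.+ a))) ⟩
      Σ< K (λ k → v k + - 1ℚ * p k)     ≡⟨ Σ-+ K v (λ k → - 1ℚ * p k) ⟩
      Σ< K v + Σ< K (λ k → - 1ℚ * p k)  ≡⟨ cong (Σ< K v +_) (Σ-* K (- 1ℚ) p) ⟩
      Σ< K v + - 1ℚ * Σ< K p
        ≡⟨ cong₂ (λ x y → x + - 1ℚ * y) (Σ-snoc-0 K v (C-vanish (D f K (2 ℕ.+ (N ∸ K ℕ.* 2 ℕ.+ a))) N<2K))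
                                          (Σ-snoc-0 K p (C-vanish (D f K (N ∸ K ℕ.* 2 ℕ.+ a)) N<2K)) ⟨
      z + Σ< K t₀ + - 1ℚ * P f K N a ∎
      where
      v p : ℕ → ℚ
      v k = ι (N C (k ℕ.* 2)) * D f k (2 ℕ.+ (N ∸ k ℕ.* 2 ℕ.+ a))
      p k = ι (N C (k ℕ.* 2)) * D f k (N ∸ k ℕ.* 2 ℕ.+ a)

  -- Both sides obey the Chebyshev recurrence and agree at N = 0 and N = 1. The bound N ≤ 2K + 1
  -- ensures that no nonzero binom(N, 2k) is cut off.
  T≡P : ∀ f K N a → N ℕ.≤ suc (K ℕ.* 2) → T f N a ≡ P f K N a
  T≡P f K 0 a _ = trans (solve 1 (λ x → x := con 1ℚ :* x :+ con 0ℚ) refl (f a))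
    (cong (ι 1 * f a +_) (sym (Σ-zero K
      (λ k → ι (0 C (suc k ℕ.* 2)) * D f (suc k) (0 ∸ suc k ℕ.* 2 ℕ.+ a))
      (λ k → C-vanish {0} {suc k ℕ.* 2} (D f (suc k) (0 ∸ suc k ℕ.* 2 ℕ.+ a)) (s≤s z≤n)))))
  T≡P f K 1 a _ = trans (solve 1 (λ x → x := con 1ℚ :* x :+ con 0ℚ) refl (f (suc a)))
    (cong (ι 1 * f (suc a) +_) (sym (Σ-zero K
      (λ k → ι (1 C (suc k ℕ.* 2)) * D f (suc k) (1 ∸ suc k ℕ.* 2 ℕ.+ a))
      (λ k → C-vanish {1} {suc k ℕ.* 2} (D f (suc k) (1 ∸ suc k ℕ.* 2 ℕ.+ a)) (s≤s (s≤s z≤n))))))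
  T≡P f K (suc (suc N)) a (s≤s 1+N≤2K) = trans
    (cong₂ (λ x y → ι 2 * x - y) (T≡P f K (suc N) (suc a) (ℕₚ.m≤n⇒m≤1+n 1+N≤2K))
                         (T≡P f K N a (ℕₚ.≤-trans (ℕₚ.n≤1+n N) (ℕₚ.m≤n⇒m≤1+n 1+N≤2K))))
    (sym (P-rec f K N a 1+N≤2K))

  -- Moments on [0, 1] and the beta integral

  -- The moments ∫₀¹ x^b dx.
  μ : ℕ → ℚ
  μ b = inv (suc b)

  inv-suc* : ∀ m n → inv n ≡ ι (suc m) * inv (suc m ℕ.* n)
  inv-suc* m n = begin
    inv n                                 ≡⟨ ℚₚ.*-identityˡ (inv n) ⟨
    1ℚ * inv n                            ≡⟨ cong (_* inv n) (ι-inv (suc m)) ⟨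
    ι (suc m) * inv (suc m) * inv n       ≡⟨ ℚₚ.*-assoc (ι (suc m)) (inv (suc m)) (inv n) ⟩
    ι (suc m) * (inv (suc m) * inv n)     ≡⟨ cong (ι (suc m) *_) (inv-* (suc m) n) ⟨
    ι (suc m) * inv (suc m ℕ.* n)         ∎

  -- The integral of x^(2r+1) (x²-1)^k over [0, 1], which the substitution u = x² turns into (-1)^k
  -- B(r+1, k+1)/2. The induction on k expands one factor x² - 1, using the cases r + 1 and r.
  beta-factorial : ∀ k r → D μ k (suc (r ℕ.* 2)) ≡ sgn k * (ι (k !) * ι (r !) * inv (2 ℕ.* suc (k ℕ.+ r) !))
  beta-factorial zero r = begin
    inv (suc r ℕ.* 2)                              ≡⟨ ℚₚ.*-identityˡ (inv (suc r ℕ.* 2)) ⟨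
    1ℚ * inv (suc r ℕ.* 2)                         ≡⟨ cong (_* inv (suc r ℕ.* 2)) (ι-inv (r !) {{r ℕₚ.!≢0}}) ⟨
    ι (r !) * inv (r !) * inv (suc r ℕ.* 2)
      ≡⟨ solve 3 (λ a b c → a :* b :* c := con 1ℚ :* (con 1ℚ :* a :* (b :* c))) refl
           (ι (r !)) (inv (r !)) (inv (suc r ℕ.* 2)) ⟩
    1ℚ * (1ℚ * ι (r !) * (inv (r !) * inv (suc r ℕ.* 2)))
      ≡⟨ cong (λ x → 1ℚ * (1ℚ * ι (r !) * x)) (inv-* (r !) (suc r ℕ.* 2)) ⟨
    1ℚ * (1ℚ * ι (r !) * inv (r ! ℕ.* (suc r ℕ.* 2)))
      ≡⟨ cong (λ m → 1ℚ * (1ℚ * ι (r !) * inv m)) (ℕS.solve 2 (λ f s → f ℕS.:* (s ℕS.:* ℕS.con 2)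
           ℕS.:= ℕS.con 2 ℕS.:* (s ℕS.:* f)) refl (r !) (suc r)) ⟩
    1ℚ * (1ℚ * ι (r !) * inv (2 ℕ.* (suc r) !)) ∎
  beta-factorial (suc k) r = begin
    D μ k (suc (suc r ℕ.* 2)) - D μ k (suc (r ℕ.* 2))
      ≡⟨ cong₂ _-_ (beta-factorial k (suc r)) (beta-factorial k r) ⟩
    s * (ι (k !) * ι ((suc r) !) * inv (2 ℕ.* suc (k ℕ.+ suc r) !)) - s * (ι (k !) * ι (r !) * inv (2 ℕ.* M !))
      ≡⟨ cong₂ (λ x y → s * x - s * (ι (k !) * ι (r !) * y)) (cong₂ (λ x y → ι (k !) * x * inv (2 ℕ.* suc y !))
             (ι-* (suc r) (r !)) (ℕₚ.+-suc k r)) invM ⟩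
    s * (ι (k !) * (ι (suc r) * ι (r !)) * x) - s * (ι (k !) * ι (r !) * ((ι (suc k) + ι (suc r)) * x))
      ≡⟨ solve 6 (λ s a b c d x → s :* (a :* (d :* b) :* x) :- s :* (a :* b :* ((c :+ d) :* x))
           := :- s :* (c :* a :* b :* x)) refl s (ι (k !)) (ι (r !)) (ι (suc k)) (ι (suc r)) x ⟩
    - s * (ι (suc k) * ι (k !) * ι (r !) * x)
      ≡⟨ cong₂ (λ s y → s * (y * ι (r !) * x)) (sgn-suc k) (ι-* (suc k) (k !)) ⟨
    sgn (suc k) * (ι (suc k !) * ι (r !) * x) ∎
    where
    s = sgn k
    M = suc (k ℕ.+ r)
    x = inv (2 ℕ.* suc M !)
    -- Common denominator 2 (M+1)!, where M + 1 = (k+1) + (r+1); the numerators then differ by k +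
    -- 1, the new factor of (k+1)!.
    invM : inv (2 ℕ.* M !) ≡ (ι (suc k) + ι (suc r)) * x
    invM = begin
      inv (2 ℕ.* M !)                            ≡⟨ inv-suc* M (2 ℕ.* M !) ⟩
      ι (suc M) * inv (suc M ℕ.* (2 ℕ.* M !))    ≡⟨ cong₂ (λ a b → ι a * inv b) (cong suc (sym (ℕₚ.+-suc k r)))
             (ℕS.solve 2 (λ m f → m ℕS.:* (ℕS.con 2 ℕS.:* f) ℕS.:= ℕS.con 2 ℕS.:* (m ℕS.:* f)) refl
                  (suc M) (M !)) ⟩
      ι (suc k ℕ.+ suc r) * x                    ≡⟨ cong (_* x) (ι-+ (suc k) (suc r)) ⟩
      (ι (suc k) + ι (suc r)) * x                ∎

  beta : ∀ n k r → n ≡ k ℕ.+ r → D μ k (suc (r ℕ.* 2)) ≡ sgn k * (inv 2 * inv (suc n) * inv (n C k))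
  beta n k r refl = trans (beta-factorial k r) (cong (sgn k *_) (begin
    ι (k !) * ι (r !) * inv (2 ℕ.* (suc n ℕ.* n !)) ≡⟨ cong (_* inv (2 ℕ.* suc n !)) (ι-* (k !) (r !)) ⟨
    ι w * inv (2 ℕ.* (suc n ℕ.* n !))
      -- Writing n! as binom(n, k) k! r! makes the numerator cancel.
      ≡⟨ cong (λ m → ι w * inv (2 ℕ.* (suc n ℕ.* m))) n! ⟨
    ι w * inv (2 ℕ.* (suc n ℕ.* ((n C k) ℕ.* w)))
      ≡⟨ cong (ι w *_) (trans (inv-* 2 (suc n ℕ.* ((n C k) ℕ.* w)))
           (cong (inv 2 *_) (trans (inv-* (suc n) ((n C k) ℕ.* w)) (cong (inv (suc n) *_) (inv-* (n C k) w))))) ⟩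
    ι w * (inv 2 * (inv (suc n) * (inv (n C k) * inv w)))
      ≡⟨ solve 5 (λ w a b c v → w :* (a :* (b :* (c :* v))) := (a :* b :* c) :* (w :* v)) refl
           (ι w) (inv 2) (inv (suc n)) (inv (n C k)) (inv w) ⟩
    (inv 2 * inv (suc n) * inv (n C k)) * (ι w * inv w)
      ≡⟨ cong ((inv 2 * inv (suc n) * inv (n C k)) *_) (ι-inv w {{k ℕₚ.!* r !≢0}}) ⟩
    (inv 2 * inv (suc n) * inv (n C k)) * 1ℚ ≡⟨ ℚₚ.*-identityʳ _ ⟩
    inv 2 * inv (suc n) * inv (n C k) ∎))
    where
    w = k ! ℕ.* r !
    n! : (n C k) ℕ.* w ≡ n !
    n! = subst (λ m → (m C k) ℕ.* w ≡ m !) (ℕₚ.+-comm r k) (C-factorial r k)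

  -- The condition on b turns each exponent N - 2k + b into the odd number 2(n-k) + 1 that `beta`
  -- evaluates. It also gives N ≤ 2n + 1, so `T≡P` applies with K = n.
  T-μ : ∀ n N b → b ℕ.+ N ≡ suc (n ℕ.* 2) →
    T μ N b ≡ inv 2 * inv (suc n) * Σ< (suc n) (λ k → sgn k * (ι (N C (k ℕ.* 2)) * inv (n C k)))
  T-μ n N b b+N = begin
    T μ N b ≡⟨ T≡P μ n N b (subst (N ℕ.≤_) b+N (ℕₚ.m≤n+m N b)) ⟩
    P μ n N b ≡⟨ Σ-cong (suc n) term ⟩
    Σ< (suc n) (λ k → inv 2 * inv (suc n) * (sgn k * (ι (N C (k ℕ.* 2)) * inv (n C k))))
      ≡⟨ Σ-* (suc n) (inv 2 * inv (suc n)) (λ k → sgn k * (ι (N C (k ℕ.* 2)) * inv (n C k))) ⟩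
    inv 2 * inv (suc n) * Σ< (suc n) (λ k → sgn k * (ι (N C (k ℕ.* 2)) * inv (n C k))) ∎
    where
    term : ∀ k → k ℕ.< suc n → ι (N C (k ℕ.* 2)) * D μ k (N ∸ k ℕ.* 2 ℕ.+ b) ≡
      inv 2 * inv (suc n) * (sgn k * (ι (N C (k ℕ.* 2)) * inv (n C k)))
    term k (s≤s k≤n) = trans
      (C-guard N (k ℕ.* 2) (λ 2k≤N → trans (cong (D μ k) (index 2k≤N)) (beta n k (n ∸ k) (sym (ℕₚ.m+[n∸m]≡n k≤n)))))
      (solve 5 (λ c s x y z → c :* (s :* (x :* y :* z)) := x :* y :* (s :* (c :* z))) refl
        (ι (N C (k ℕ.* 2))) (sgn k) (inv 2) (inv (suc n)) (inv (n C k)))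
      where
      index : k ℕ.* 2 ℕ.≤ N → N ∸ k ℕ.* 2 ℕ.+ b ≡ suc ((n ∸ k) ℕ.* 2)
      index 2k≤N = begin
        N ∸ k ℕ.* 2 ℕ.+ b        ≡⟨ ℕₚ.+-comm (N ∸ k ℕ.* 2) b ⟩
        b ℕ.+ (N ∸ k ℕ.* 2)      ≡⟨ ℕₚ.+-∸-assoc b 2k≤N ⟨
        b ℕ.+ N ∸ k ℕ.* 2        ≡⟨ cong (_∸ k ℕ.* 2) b+N ⟩
        suc (n ℕ.* 2) ∸ k ℕ.* 2  ≡⟨ ℕₚ.+-∸-assoc 1 (ℕₚ.*-monoˡ-≤ 2 k≤n) ⟩
        suc (n ℕ.* 2 ∸ k ℕ.* 2)  ≡⟨ cong suc (ℕₚ.*-distribʳ-∸ 2 n k) ⟨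
        suc ((n ∸ k) ℕ.* 2)      ∎

  -- The double sum as a Chebyshev moment

  C-reflect : ∀ N i → i ℕ.≤ N → (N ℕ.+ i) C (N ∸ i) ≡ (i ℕ.+ N) C (i ℕ.* 2)
  C-reflect N i i≤N = sym (begin
    (i ℕ.+ N) C (i ℕ.* 2)              ≡⟨ cong ((i ℕ.+ N) C_) i*2≡i+i ⟩
    (i ℕ.+ N) C (i ℕ.+ i)              ≡⟨ nCk≡nC[n∸k] (ℕₚ.+-monoʳ-≤ i i≤N) ⟩
    (i ℕ.+ N) C (i ℕ.+ N ∸ (i ℕ.+ i))  ≡⟨ cong₂ _C_ (ℕₚ.+-comm i N) (ℕₚ.[m+n]∸[m+o]≡n∸o i N i) ⟩
    (N ℕ.+ i) C (N ∸ i)                ∎)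
    where
    i*2≡i+i : i ℕ.* 2 ≡ i ℕ.+ i
    i*2≡i+i = ℕS.solve 1 (λ i → i ℕS.:* ℕS.con 2 ℕS.:= i ℕS.:+ i) refl i

  -- On the diagonal i = k + j the sum over j collapses to ⟨x^b (1+x)^i⟩ by `W-sum`. The sum over i
  -- is then 1/(2N) times two consecutive `V`, which `V+V≡2T` evaluates; here N stands for the
  -- successor in the statement.
  double-sum : ∀ f N b → Σ< (2 ℕ.+ N) (λ j → Σ< (2 ℕ.+ N ∸ j) (λ k →
      pow-2 (k ℕ.+ j) * (inv (suc N ℕ.+ (k ℕ.+ j)) * f (j ℕ.+ b))
        * ι ((suc N ℕ.+ (k ℕ.+ j)) C (suc N ∸ (k ℕ.+ j))) * ι ((k ℕ.+ j) C j)))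
    ≡ sgn (suc N) * inv (suc N) * T f (suc N) b
  double-sum f N₀ b = begin
    Σ< (suc N) (λ j → Σ< (suc N ∸ j) (λ k → g (k ℕ.+ j) j))
      ≡⟨ Σ-triangle (suc N) (λ k j → g (k ℕ.+ j) j) ⟩
    Σ< (suc N) (λ i → Σ< (suc i) (λ j → g (i ∸ j ℕ.+ j) j))
      ≡⟨ Σ-cong (suc N) row ⟩
    Σ< (suc N) (λ i → inv (2 ℕ.* N) * (t (suc N) i + t N i))
      ≡⟨ Σ-* (suc N) (inv (2 ℕ.* N)) (λ i → t (suc N) i + t N i) ⟩
    inv (2 ℕ.* N) * Σ< (suc N) (λ i → t (suc N) i + t N i)
      ≡⟨ cong (inv (2 ℕ.* N) *_) (trans (Σ-+ (suc N) (t (suc N)) (t N)) (V+V≡2T f N N b ℕₚ.≤-refl)) ⟩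
    inv (2 ℕ.* N) * (ι 2 * (sgn N * T f N b))
      ≡⟨ cong (_* (ι 2 * (sgn N * T f N b))) (inv-* 2 N) ⟩
    inv 2 * inv N * (ι 2 * (sgn N * T f N b))
      ≡⟨ solve 3 (λ v s t → con (inv 2) :* v :* (con (ι 2) :* (s :* t)) := s :* v :* t) refl
           (inv N) (sgn N) (T f N b) ⟩
    sgn N * inv N * T f N b ∎
    where
    N = suc N₀
    g : ℕ → ℕ → ℚ
    g i j = pow-2 i * (inv (N ℕ.+ i) * f (j ℕ.+ b)) * ι ((N ℕ.+ i) C (N ∸ i)) * ι (i C j)
    t : ℕ → ℕ → ℚ
    t M i = ι (vCoeff M i) * (pow-2 i * W f i b)
    row : ∀ i → i ℕ.< suc N → Σ< (suc i) (λ j → g (i ∸ j ℕ.+ j) j) ≡ inv (2 ℕ.* N) * (t (suc N) i + t N i)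
    row i (s≤s i≤N) = begin
      Σ< (suc i) (λ j → g (i ∸ j ℕ.+ j) j)
        ≡⟨ Σ-cong (suc i) (λ { j (s≤s j≤i) → trans (cong (λ i → g i j) (ℕₚ.m∸n+n≡m j≤i))
             (solve 5 (λ p v x c d → p :* (v :* x) :* c :* d := p :* (v :* c) :* (d :* x)) refl
               (pow-2 i) (inv (N ℕ.+ i)) (f (j ℕ.+ b)) (ι ((N ℕ.+ i) C (N ∸ i))) (ι (i C j))) }) ⟩
      Σ< (suc i) (λ j → q * (ι (i C j) * f (j ℕ.+ b)))
        ≡⟨ Σ-* (suc i) q (λ j → ι (i C j) * f (j ℕ.+ b)) ⟩
      q * Σ< (suc i) (λ j → ι (i C j) * f (j ℕ.+ b))
        ≡⟨ cong₂ (λ x y → pow-2 i * x * y) coeff (sym (W-sum f i b)) ⟩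
      pow-2 i * (inv (2 ℕ.* N) * (ι (vCoeff (suc N) i) + ι (vCoeff N i))) * W f i b
        ≡⟨ solve 5 (λ p v x y w → p :* (v :* (x :+ y)) :* w := v :* (x :* (p :* w) :+ y :* (p :* w))) refl
             (pow-2 i) (inv (2 ℕ.* N)) (ι (vCoeff (suc N) i)) (ι (vCoeff N i)) (W f i b) ⟩
      inv (2 ℕ.* N) * (t (suc N) i + t N i) ∎
      where
      q = pow-2 i * (inv (N ℕ.+ i) * ι ((N ℕ.+ i) C (N ∸ i)))
      -- Exchanges the denominator N + i, which varies with the diagonal, for the constant 2N, which
      -- can leave the sum over i.
      coeff : inv (N ℕ.+ i) * ι ((N ℕ.+ i) C (N ∸ i)) ≡ inv (2 ℕ.* N) * (ι (vCoeff (suc N) i) + ι (vCoeff N i))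
      coeff = begin
        inv (N ℕ.+ i) * ι ((N ℕ.+ i) C (N ∸ i))  ≡⟨ cong (λ c → inv (N ℕ.+ i) * ι c) (C-reflect N i i≤N) ⟩
        inv (N ℕ.+ i) * ι ((i ℕ.+ N) C (i ℕ.* 2))
          ≡⟨ inv-cross (2 ℕ.* N) (N ℕ.+ i) ((i ℕ.+ N) C (i ℕ.* 2)) ((i ℕ.+ N) C (i ℕ.* 2) ℕ.+ vCoeff N i)
               (sym (C-chebyshev i N i≤N)) ⟩
        inv (2 ℕ.* N) * ι ((i ℕ.+ N) C (i ℕ.* 2) ℕ.+ vCoeff N i)
          ≡⟨ cong (inv (2 ℕ.* N) *_) (ι-+ ((i ℕ.+ N) C (i ℕ.* 2)) (vCoeff N i)) ⟩
        inv (2 ℕ.* N) * (ι ((i ℕ.+ N) C (i ℕ.* 2)) + ι (vCoeff N i))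
          ≡⟨ cong (λ m → inv (2 ℕ.* N) * (ι ((m ∸ 1) C (i ℕ.* 2)) + ι (vCoeff N i))) (ℕₚ.+-suc i N) ⟨
        inv (2 ℕ.* N) * (ι (vCoeff (suc N) i) + ι (vCoeff N i)) ∎

-- Passage to the integer formulation

open import Data.Integer.Base using (ℤ; +_; -_; _+_; _-_; _*_; _^_; _≤_; _>_; ∣_∣; +≤+; +<+)
open ℤS using (solve; con; _:=_; _:+_; _:*_; _:-_)
open ChebyshevMoments

pos-∸ : ∀ {m n} → n ℕ.≤ m → + m - + n ≡ + (m ∸ n)
pos-∸ {m} {n} n≤m = trans (ℤₚ.m-n≡m⊖n m n) (ℤₚ.⊖-≥ n≤m)

sumTo-∸ : ∀ N j (f : ℕ → ℚ) → j ℕ.≤ N → (∑[ k ≤ + N - + j ] f k) ≡ Σ< (suc N ∸ j) f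
sumTo-∸ N j f j≤N = trans (cong (λ z → sumTo z f) (pos-∸ j≤N)) (cong (λ m → Σ< m f) (sym (ℕₚ.+-∸-assoc 1 j≤N)))

-- The parameters p and q make all three identities instances of one; at `q = + 0` the factor
-- `q + + j + + 2` computes to `+ j + + 2`.
summand : ℤ → ℤ → ℕ → ℕ → ℚ
summand p q k j =
  ((- + 2) ^ (k ℕ.+ j) ÷ᶻ ((p + + k + + j) * (q + + j + + 2)))
    ℚ.* fromℤ (binom (p + + k + + j) (p - + k - + j))
    ℚ.* fromℤ (binom (+ k + + j) (+ j))

quotientSum : ℤ → ℕ → ℚ
quotientSum p n = ∑[ k ≤ + n ] (fromℤ ((- + 1) ^ k) ℚ.* (binom p (+ 2 * + k) ÷ᶻ binom (+ n) (+ k)))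

-- In the paper's notation p = n + m and q = n - m.
double-sum≡quotientSum : ∀ n p q N b → p ≡ + suc N → q + + 2 ≡ + suc b → b ℕ.+ suc N ≡ suc (n ℕ.* 2) →
  (∑[ j ≤ p ] (∑[ k ≤ p - + j ] summand p q k j))
  ≡ ((- + 1) ^ ∣ p ∣ ÷ᶻ (+ 2 * (+ n + + 1) * p)) ℚ.* quotientSum p n
double-sum≡quotientSum n p q N₀ b refl q+2 b+N = begin
  (∑[ j ≤ + N ] (∑[ k ≤ + N - + j ] summand (+ N) q k j))
    ≡⟨ Σ-cong (suc N) row ⟩
  Σ< (suc N) (λ j → Σ< (suc N ∸ j) (λ k → g (k ℕ.+ j) j))
    ≡⟨ double-sum μ N₀ b ⟩
  sgn N ℚ.* inv N ℚ.* T μ N b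
    ≡⟨ cong (sgn N ℚ.* inv N ℚ.*_) (T-μ n N b b+N) ⟩
  sgn N ℚ.* inv N ℚ.* (inv 2 ℚ.* inv (suc n) ℚ.* Σ< (suc n) r)
    ≡⟨ ℚS.solve 5 (λ s v a b r → s ℚS.:* v ℚS.:* (a ℚS.:* b ℚS.:* r) ℚS.:= s ℚS.:* (a ℚS.:* b ℚS.:* v) ℚS.:* r) refl
         (sgn N) (inv N) (inv 2) (inv (suc n)) (Σ< (suc n) r) ⟩
  sgn N ℚ.* (inv 2 ℚ.* inv (suc n) ℚ.* inv N) ℚ.* Σ< (suc n) r
    ≡⟨ cong₂ ℚ._*_ prefactor (Σ-cong (suc n) (λ k _ → rhs k)) ⟨
  ((- + 1) ^ N ÷ᶻ (+ 2 * (+ n + + 1) * + N)) ℚ.* quotientSum (+ N) n ∎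
  where
  N = suc N₀
  g : ℕ → ℕ → ℚ
  g i j = pow-2 i ℚ.* (inv (N ℕ.+ i) ℚ.* μ (j ℕ.+ b)) ℚ.* ι ((N ℕ.+ i) C (N ∸ i)) ℚ.* ι (i C j)
  r : ℕ → ℚ
  r k = sgn k ℚ.* (ι (N C (k ℕ.* 2)) ℚ.* inv (n C k))
  rhs : ∀ k → fromℤ ((- + 1) ^ k) ℚ.* (binom (+ N) (+ 2 * + k) ÷ᶻ binom (+ n) (+ k)) ≡ r k
  rhs k = cong (sgn k ℚ.*_) (trans
    (cong (λ i → binom (+ N) i ÷ᶻ + (n C k)) (trans (sym (ℤₚ.pos-* 2 k)) (cong +_ (ℕₚ.*-comm 2 k))))
    (÷ᶻ-inv (+ (N C (k ℕ.* 2))) (n C k)))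
  prefactor : (- + 1) ^ N ÷ᶻ (+ 2 * (+ n + + 1) * + N) ≡ sgn N ℚ.* (inv 2 ℚ.* inv (suc n) ℚ.* inv N)
  prefactor = begin
    (- + 1) ^ N ÷ᶻ (+ 2 * (+ n + + 1) * + N)
      ≡⟨ cong (λ m → (- + 1) ^ N ÷ᶻ (+ 2 * + m * + N)) (ℕₚ.+-comm n 1) ⟩
    (- + 1) ^ N ÷ᶻ (+ (2 ℕ.* suc n ℕ.* N))     ≡⟨ ÷ᶻ-inv ((- + 1) ^ N) (2 ℕ.* suc n ℕ.* N) ⟩
    sgn N ℚ.* inv (2 ℕ.* suc n ℕ.* N)
      ≡⟨ cong (sgn N ℚ.*_) (trans (inv-* (2 ℕ.* suc n) N) (cong (ℚ._* inv N) (inv-* 2 (suc n)))) ⟩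
    sgn N ℚ.* (inv 2 ℚ.* inv (suc n) ℚ.* inv N) ∎
  -- Within the triangle k + j ≤ N the lower entry N - k - j is non-negative, so integer and
  -- truncated subtraction agree.
  term : ∀ j k → k ℕ.+ j ℕ.≤ N → summand (+ N) q k j ≡ g (k ℕ.+ j) j
  term j k k+j≤N = cong (ℚ._* ι ((k ℕ.+ j) C j)) (cong₂ ℚ._*_ quotient (cong fromℤ (cong₂ binom top bottom)))
    where
    top : + N + + k + + j ≡ + (N ℕ.+ (k ℕ.+ j))
    top = cong +_ (ℕₚ.+-assoc N k j)
    bottom : + N - + k - + j ≡ + (N ∸ (k ℕ.+ j))
    bottom = trans (solve 3 (λ n k j → n :- k :- j := n :- (k :+ j)) refl (+ N) (+ k) (+ j)) (pos-∸ k+j≤N)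
    right : q + + j + + 2 ≡ + suc (j ℕ.+ b)
    right = begin
      q + + j + + 2       ≡⟨ solve 2 (λ q j → q :+ j :+ con (+ 2) := j :+ (q :+ con (+ 2))) refl q (+ j) ⟩
      + j + (q + + 2)     ≡⟨ cong (λ z → + j + z) q+2 ⟩
      + (j ℕ.+ suc b)     ≡⟨ cong +_ (ℕₚ.+-suc j b) ⟩
      + suc (j ℕ.+ b)     ∎
    quotient : (- + 2) ^ (k ℕ.+ j) ÷ᶻ ((+ N + + k + + j) * (q + + j + + 2)) ≡
      pow-2 (k ℕ.+ j) ℚ.* (inv (N ℕ.+ (k ℕ.+ j)) ℚ.* μ (j ℕ.+ b))
    quotient = begin
      (- + 2) ^ (k ℕ.+ j) ÷ᶻ ((+ N + + k + + j) * (q + + j + + 2))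
        ≡⟨ cong ((- + 2) ^ (k ℕ.+ j) ÷ᶻ_) (cong₂ _*_ top right) ⟩
      (- + 2) ^ (k ℕ.+ j) ÷ᶻ (+ ((N ℕ.+ (k ℕ.+ j)) ℕ.* suc (j ℕ.+ b)))
        ≡⟨ ÷ᶻ-inv ((- + 2) ^ (k ℕ.+ j)) ((N ℕ.+ (k ℕ.+ j)) ℕ.* suc (j ℕ.+ b)) ⟩
      pow-2 (k ℕ.+ j) ℚ.* inv ((N ℕ.+ (k ℕ.+ j)) ℕ.* suc (j ℕ.+ b))
        ≡⟨ cong (pow-2 (k ℕ.+ j) ℚ.*_) (inv-* (N ℕ.+ (k ℕ.+ j)) (suc (j ℕ.+ b))) ⟩
      pow-2 (k ℕ.+ j) ℚ.* (inv (N ℕ.+ (k ℕ.+ j)) ℚ.* μ (j ℕ.+ b)) ∎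
  row : ∀ j → j ℕ.< suc N → (∑[ k ≤ + N - + j ] summand (+ N) q k j) ≡ Σ< (suc N ∸ j) (λ k → g (k ℕ.+ j) j)
  row j (s≤s j≤N) = trans (sumTo-∸ N j (λ k → summand (+ N) q k j) j≤N)
    (Σ-cong (suc N ∸ j) (λ k k<1+N-j → term j k
      (ℕₚ.≤-pred (ℕₚ.m≤o∸n⇒m+n≤o (suc k) (ℕₚ.m≤n⇒m≤1+n j≤N) k<1+N-j))))

positive⇒suc : ∀ {z} → z > + 0 → ∃ λ N → z ≡ + suc N
positive⇒suc (+<+ {n = suc N} _) = N , refl

nonNegative⇒pos : ∀ {z} → + 0 ≤ z → ∃ λ b → z ≡ + b
nonNegative⇒pos (+≤+ {n = b} _) = b , refl

theorem27 : ( (n : ℕ) (m : ℤ) → + n + m > + 0 → m - + 1 ≤ + n →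
    (∑[ j ≤ + n + m ] (∑[ k ≤ + n + m - + j ]
    ( ((- + 2) ^ (k ℕ.+ j) ÷ᶻ ((+ n + m + + k + + j) * (+ n - m + + j + + 2)))
    ℚ.* fromℤ (binom (+ n + m + + k + + j) (+ n + m - + k - + j))
    ℚ.* fromℤ (binom (+ k + + j) (+ j)) )))
    ≡ ((- + 1) ^ ∣ + n + m ∣ ÷ᶻ (+ 2 * (+ n + + 1) * (+ n + m)))
    ℚ.* (∑[ k ≤ + n ] (fromℤ ((- + 1) ^ k) ℚ.* (binom (+ n + m) (+ 2 * + k) ÷ᶻ binom (+ n) (+ k)))) )
    ×
    ( (n : ℕ) → n ℕ.≥ 1 →
    (∑[ j ≤ + n ] (∑[ k ≤ + n - + j ]
    ( ((- + 2) ^ (k ℕ.+ j) ÷ᶻ ((+ n + + k + + j) * (+ n + + j + + 2)))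
    ℚ.* fromℤ (binom (+ n + + k + + j) (+ n - + k - + j))
    ℚ.* fromℤ (binom (+ k + + j) (+ j)) )))
    ≡ ((- + 1) ^ n ÷ᶻ (+ 2 * + n * (+ n + + 1)))
    ℚ.* (∑[ k ≤ + n ] (fromℤ ((- + 1) ^ k) ℚ.* (binom (+ n) (+ 2 * + k) ÷ᶻ binom (+ n) (+ k)))) )
    ×
    ( (n : ℕ) → n ℕ.≥ 1 →
    (∑[ j ≤ + 2 * + n ] (∑[ k ≤ + 2 * + n - + j ]
    ( ((- + 2) ^ (k ℕ.+ j) ÷ᶻ ((+ 2 * + n + + k + + j) * (+ j + + 2)))
    ℚ.* fromℤ (binom (+ 2 * + n + + k + + j) (+ 2 * + n - + k - + j))
    ℚ.* fromℤ (binom (+ k + + j) (+ j)) )))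
    ≡ (+ 1 ÷ᶻ (+ 4 * + n * (+ n + + 1)))
    ℚ.* (∑[ k ≤ + n ] (fromℤ ((- + 1) ^ k) ℚ.* (binom (+ 2 * + n) (+ 2 * + k) ÷ᶻ binom (+ n) (+ k)))) )
theorem27 = general , m=0 , m=n
  where
  general : (n : ℕ) (m : ℤ) → + n + m > + 0 → m - + 1 ≤ + n → _
  -- Here b is the exponent n - m + 1, a natural number exactly because m - 1 ≤ n; then b + (n+m) =
  -- 2n + 1.
  general n m p>0 m-1≤n with positive⇒suc p>0 | nonNegative⇒pos (ℤₚ.i≤j⇒0≤j-i m-1≤n)
  ... | N , p | b , q = double-sum≡quotientSum n (+ n + m) (+ n - m) N b p q+2 b+N
    where
    q+2 : + n - m + + 2 ≡ + suc b
    q+2 = begin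
      + n - m + + 2
        ≡⟨ solve 2 (λ n m → n :- m :+ con (+ 2) := con (+ 1) :+ (n :- (m :- con (+ 1)))) refl (+ n) m ⟩
      + 1 + (+ n - (m - + 1))    ≡⟨ cong (λ z → + 1 + z) q ⟩
      + suc b                    ∎
    b+N : b ℕ.+ suc N ≡ suc (n ℕ.* 2)
    b+N = ℤₚ.+-injective (begin
      + b + + suc N                      ≡⟨ cong₂ _+_ q p ⟨
      + n - (m - + 1) + (+ n + m)
        ≡⟨ solve 2 (λ n m → n :- (m :- con (+ 1)) :+ (n :+ m) := con (+ 1) :+ n :* con (+ 2)) refl (+ n) m ⟩
      + 1 + + n * + 2                    ≡⟨ cong (λ z → + 1 + z) (ℤₚ.pos-* n 2) ⟨
      + suc (n ℕ.* 2)                    ∎)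
  m=0 : (n : ℕ) → n ℕ.≥ 1 → _
  m=0 (suc N) _ = trans
    -- For m = 0 the exponent b is n + 1; afterwards only the factors of the denominator are
    -- reordered.
    (double-sum≡quotientSum n (+ n) (+ n) N (suc n) refl (cong +_ (ℕₚ.+-comm n 2))
      (cong suc (trans (cong (n ℕ.+_) (sym (ℕₚ.+-identityʳ n))) (ℕₚ.*-comm 2 n))))
    (cong (λ d → ((- + 1) ^ n ÷ᶻ d) ℚ.* quotientSum (+ n) n)
      (solve 1 (λ n → con (+ 2) :* (n :+ con (+ 1)) :* n := con (+ 2) :* n :* (n :+ con (+ 1))) refl (+ n)))
    where n = suc N
  m=n : (n : ℕ) → n ℕ.≥ 1 → _
  m=n (suc N) _ = trans
    -- For m = n the exponent b is 1, and the sign (-1)^(2n) becomes 1.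
    (double-sum≡quotientSum n (+ 2 * + n) (+ 0) (N ℕ.+ suc (N ℕ.+ 0)) 1 refl refl (cong suc (ℕₚ.*-comm 2 n)))
    (cong₂ (λ s d → (s ÷ᶻ d) ℚ.* quotientSum (+ 2 * + n) n)
      (trans (sym (ℤₚ.^-*-assoc (- + 1) 2 n)) (ℤₚ.^-zeroˡ n))
      (solve 1 (λ n → con (+ 2) :* (n :+ con (+ 1)) :* (con (+ 2) :* n) := con (+ 4) :* n :* (n :+ con (+ 1))) refl
           (+ n)))
    where n = suc N
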